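{- Let $(N_1,m_1)$ and $(N_2,m_2)$ be labeled marked Petri nets and $E$ a system of linear constraints with $(N_1,m_1)\vartriangleright_E(N_2,m_2)$, and let $(M,m)$ be a labeled marked Petri net that is compatible with respect to this equivalence. Then $(N_1,m_1)\,\|\,(M,m)\vartriangleright_E(N_2,m_2)\,\|\,(M,m)$.
   Context: A Petri net $N=(P,T,\mathrm{Pre},\mathrm{Post})$ has a finite set of places $P$, a finite set of transitions $T$ disjoint from $P$, and flow functions $\mathrm{Pre},\mathrm{Post}:T\to(P\to\mathbb N)$. A marking is a map $m:P\to\mathbb N$. Transition $t$ is enabled at $m$ if $m(p)\ge\mathrm{Pre}(t,p)$ for all $p$; firing it yields $m'=m-\mathrm{Pre}(t)+\mathrm{Post}(t)$. A firing sequence $\varrho$ leads from $m$ to $m'$ ($m\overset{\varrho}{\Rightarrow}m'$) if its transitions can be fired successively from $m$ reaching $m'$. A labeled net has a labeling $l:T\to\Sigma\cup\{\tau\}$ ($\tau\notin\Sigma$ silent), extended to sequences by $l(\epsilon)=\epsilon$, $\tau$ mapped to $\epsilon$, $l(\varrho t)=l(\varrho)l(t)$. Formulas are Boolean combinations of linear (in)equalities over integer variables; place names are used as variables. For a marking $m$ over $P$, $\underline m\triangleq\bigwedge_{p\in P}(p=m(p))$; $m\models\phi$ means $\phi\wedge\underline m$ is satisfiable over the integers. Markings $m_1$ over $P_1$, $m_2$ over $P_2$ are compatible if they agree on $P_1\cap P_2$; then $m_1\uplus m_2$ is the marking on $P_1\cup P_2$ agreeing with both; $m_1\uplus m_2\models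 E$ presupposes compatibility. $E$-abstraction (for $N_1,N_2$ with labelings $l_1,l_2$ over the same alphabet): $(N_1,m_1)\sqsupseteq_E(N_2,m_2)$ iff (A1) $m_1\uplus m_2\models E$; and (A2) for every firing sequence $m_1\overset{\varrho_1}{\Rightarrow}m_1'$ in $N_1$ there is at least one marking $m_2'$ over $P_2$ with $m_1'\uplus m_2'\models E$, and for every marking $m_2'$ over $P_2$ with $m_1'\uplus m_2'\models E$ there is a firing sequence $\varrho_2$ of $N_2$ with $m_2\overset{\varrho_2}{\Rightarrow}m_2'$ and $l_1(\varrho_1)=l_2(\varrho_2)$. $(N_1,m_1)\vartriangleright_E(N_2,m_2)$ means both directions hold. The fresh variables of $(N_1,m_1)\vartriangleright_E(N_2,m_2)$ are the variables in $E$ not in $P_1\cup P_2$. A net $M$ with places $P_M$ is compatible with respect to this statement when $(P_1\cup P_2)\cap P_M=\emptyset$ and no fresh variable of the statement is a place of $M$. Synchronous product: for labeled nets $N_a=(P_a,T_a,\mathrm{Pre}_a,\mathrm{Post}_a)$ with labeling $l_a$ over alphabet $\Sigma_a$ and $N_b$ likewise with $l_b$ over $\Sigma_b$, with $P_a\cap P_b=\emptyset$, $N_a\|N_b$ has places $P_a\cup P_b$ and transitions: $(t,\circ)$ for $t\in T_a$ with $l_a(t)\notin\Sigma_b$, labeled $l_a(t)$; $(\circ,t)$ for $t\in T_b$ with $l_b(t)\notin\Sigma_a$, labeled $l_b(t)$; and $(t_a,t_b)$ whenever $l_a(t_a)=l_b(t_b)$, labeled $l_a(t_a)$. $\mathrm{Pre}((t_a,t_b),p)=\mathrm{Pre}_a(t_a,p)$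 if $p\in P_a$ and $t_a\ne\circ$, $=\mathrm{Pre}_b(t_b,p)$ if $p\in P_b$ and $t_b\ne\circ$, and $0$ otherwise; similarly for $\mathrm{Post}$. For marked nets, $(N_a,m_a)\|(N_b,m_b)\triangleq(N_a\|N_b,m_a\|m_b)$ where $m_a\|m_b$ is the union marking on $P_a\cup P_b$. -}

module Defs where

open import Data.Empty using (⊥; ⊥-elim)
open import Data.Integer.Base as ℤ using (ℤ; +_)
open import Data.Irrelevant using ([_])
open import Data.List.Base
  using (List; []; _∷_; _++_; foldr; concatMap; mapMaybe; cartesianProduct)
open import Data.List.Membership.Propositional using (_∈_; _∉_; mapWith∈)
open import Data.List.Membership.Propositional.Properties
  using (∈-++⁺ˡ; ∈-++⁺ʳ; ∈-++⁻; ∈-concatMap⁺; ∈-cartesianProduct⁺)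
import Data.List.Membership.DecPropositional as DecMembership
open import Data.List.Relation.Binary.Disjoint.Propositional using (Disjoint)
open import Data.List.Relation.Unary.Any as List∃ using (here)
open import Data.List.Relation.Unary.Enumerates.Setoid using (IsEnumeration)
open import Data.Maybe.Base using (Maybe)
open import Data.Maybe.Properties using (≡-dec)
open import Data.Maybe.Relation.Unary.All as Maybe∀ using (All)
open import Data.Maybe.Relation.Unary.Any as Maybe∃ using (Any)
open import Data.Nat.Base as ℕ using (ℕ)
open import Data.Product.Base using (Σ-syntax; ∃-syntax; _×_; _,_; proj₁; proj₂)
open import Data.Refinement using (Refinement-syntax; value; _,_)
open import Data.Sum.Base using (_⊎_; inj₁; inj₂)
open import Data.Unit.Base using (⊤)
open import Level using (0ℓ)
open import Relation.Binary.Definitions using (DecidableEquality)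
open import Relation.Binary.PropositionalEquality
  using (_≡_; _≗_; refl; setoid)
open import Relation.Nullary using (¬_; Dec; yes; no)
open import Relation.Nullary.Decidable using (¬?)
open import Relation.Unary as U using (Pred)
open import Relation.Unary.Properties using (_∪?_)

-- Var is the universe of names shared by the places of all nets and the
-- variables of all formulas; Act is the universe of visible labels.

module PetriNets {Var Act : Set}
                 (_≟ᵛ_ : DecidableEquality Var)
                 (_≟ᵃ_ : DecidableEquality Act) where

  open DecMembership _≟ᵛ_ using (_∈?_)

  -- A finite set of names is a list, of which only membership matters: the
  -- proof of membership in a place is irrelevant, so places with the same
  -- name are equal, whatever the order or multiplicity of names in the list.

  Place : List Var → Set
  Place P = [ x ∈ Var ∣ x ∈ P ]

  Marking : List Var → Set
  Marking P = Place P → ℕ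

  infixr 6 _⊎ₘ_

  -- Meaningful as a union only when m and m′ are Compatible (below); it is
  -- biased to the left otherwise.

  _⊎ₘ_ : ∀ {P Q} → Marking P → Marking Q → Marking (P ++ Q)
  _⊎ₘ_ {P} {Q} m m′ (x , [ x∈P++Q ]) with x ∈? P
  ... | yes x∈P = m (x , [ x∈P ])
  ... | no  x∉P = m′ (x , [ inRight (∈-++⁻ P x∈P++Q) ])
    where
    inRight : x ∈ P ⊎ x ∈ Q → x ∈ Q
    inRight (inj₁ x∈P) = ⊥-elim (x∉P x∈P)
    inRight (inj₂ x∈Q) = x∈Q

  Compatible : ∀ {P Q} → Marking P → Marking Q → Set
  Compatible m m′ = ∀ p q → value p ≡ value q → m p ≡ m′ q

  ----------------------------------------------------------------------
  -- Formulas

  infixl 7 _·_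
  infixl 6 _⊕_
  infix  5 _≐_ _≼_
  infixr 4 _∧_
  infixr 3 _∨_

  data Term : Set where
    con : ℤ → Term
    var : Var → Term
    _⊕_ : Term → Term → Term
    _·_ : ℤ → Term → Term

  data Formula : Set where
    _≐_ _≼_ : Term → Term → Formula
    true    : Formula
    _∧_ _∨_ : Formula → Formula → Formula
    not     : Formula → Formula

  Valuation : Set
  Valuation = Var → ℤ

  ⟦_⟧ₜ : Term → Valuation → ℤ
  ⟦ con k ⟧ₜ v = k
  ⟦ var x ⟧ₜ v = v x
  ⟦ s ⊕ t ⟧ₜ v = ⟦ s ⟧ₜ v ℤ.+ ⟦ t ⟧ₜ v
  ⟦ k · t ⟧ₜ v = k ℤ.* ⟦ t ⟧ₜ v

  ⟦_⟧ : Formula → Valuation → Set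
  ⟦ s ≐ t ⟧ v = ⟦ s ⟧ₜ v ≡ ⟦ t ⟧ₜ v
  ⟦ s ≼ t ⟧ v = ⟦ s ⟧ₜ v ℤ.≤ ⟦ t ⟧ₜ v
  ⟦ true  ⟧ v = ⊤
  ⟦ φ ∧ ψ ⟧ v = ⟦ φ ⟧ v × ⟦ ψ ⟧ v
  ⟦ φ ∨ ψ ⟧ v = ⟦ φ ⟧ v ⊎ ⟦ ψ ⟧ v
  ⟦ not φ ⟧ v = ¬ ⟦ φ ⟧ v

  Satisfiable : Formula → Set
  Satisfiable φ = Σ[ v ∈ Valuation ] ⟦ φ ⟧ v

  varsₜ : Term → List Var
  varsₜ (con k) = []
  varsₜ (var x) = x ∷ []
  varsₜ (s ⊕ t) = varsₜ s ++ varsₜ t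
  varsₜ (k · t) = varsₜ t

  vars : Formula → List Var
  vars (s ≐ t) = varsₜ s ++ varsₜ t
  vars (s ≼ t) = varsₜ s ++ varsₜ t
  vars true    = []
  vars (φ ∧ ψ) = vars φ ++ vars ψ
  vars (φ ∨ ψ) = vars φ ++ vars ψ
  vars (not φ) = vars φ

  ⋀ : List Formula → Formula
  ⋀ = foldr _∧_ true

  -- ⌜ m ⌝ is the formula m̲, the conjunction of p = m(p) over all places p.

  ⌜_⌝ : ∀ {P} → Marking P → Formula
  ⌜_⌝ {P} m = ⋀ (mapWith∈ P λ {x} x∈P → var x ≐ con (+ m (x , [ x∈P ])))

  infix 4 _⊨_ ⟪_⊎_⟫⊨_

  _⊨_ : ∀ {P} → Marking P → Formula → Set
  m ⊨ φ = Satisfiable (φ ∧ ⌜ m ⌝)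

  ⟪_⊎_⟫⊨_ : ∀ {P Q} → Marking P → Marking Q → Formula → Set
  ⟪ m ⊎ m′ ⟫⊨ φ = Compatible m m′ × ((m ⊎ₘ m′) ⊨ φ)

  ----------------------------------------------------------------------
  -- Labeled nets

  record Alphabet : Set₁ where
    field
      letters : Pred Act 0ℓ
      letter? : U.Decidable letters

  open Alphabet public

  _∪ₐ_ : Alphabet → Alphabet → Alphabet
  (A ∪ₐ B) .letters = letters A U.∪ letters B
  (A ∪ₐ B) .letter? = letter? A ∪? letter? B

  -- The silent label τ is nothing. It belongs to no alphabet A, in the sense
  -- of IsLetter A, but is always allowed as a label.

  Label : Set
  Label = Maybe Act

  IsLetter : Alphabet → Label → Set
  IsLetter A = Any (letters A)

  record Net (A : Alphabet) : Set₁ where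
    field
      places      : List Var
      Transition  : Set
      transitions : List Transition
      complete    : IsEnumeration (setoid Transition) transitions
      Pre Post    : Transition → Place places → ℕ
      label       : Transition → Label
      label-valid : ∀ t → All (letters A) (label t)

  open Net public

  MarkedNet : Alphabet → Set₁
  MarkedNet A = Σ[ N ∈ Net A ] Marking (places N)

  module _ {A} (N : Net A) where

    Enabled : Marking (places N) → Transition N → Set
    Enabled m t = ∀ p → Pre N t p ℕ.≤ m p

    record Fires (m : Marking (places N)) (t : Transition N)
                 (m′ : Marking (places N)) : Set where
      field
        enabled : Enabled m t
        result  : ∀ p → m′ p ≡ m p ℕ.∸ Pre N t p ℕ.+ Post N t p

    -- Markings are functions and are only compared pointwise.

    data FiringSequence : Marking (places N) → List (Transition N) →
                          Marking (places N) → Set where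
      []  : ∀ {m m′} → m ≗ m′ → FiringSequence m [] m′
      _∷_ : ∀ {m m′ m″ t ϱ} → Fires m t m′ → FiringSequence m′ ϱ m″ →
            FiringSequence m (t ∷ ϱ) m″

    labels : List (Transition N) → List Act
    labels = mapMaybe (label N)

  ----------------------------------------------------------------------
  -- E-abstraction equivalence

  infix 3 _⊒[_]_ _▷[_]_

  record _⊒[_]_ {A} (𝓝₁ : MarkedNet A) (E : Formula) (𝓝₂ : MarkedNet A) : Set where
    private
      N₁ = proj₁ 𝓝₁
      N₂ = proj₁ 𝓝₂
      m₁ = proj₂ 𝓝₁
      m₂ = proj₂ 𝓝₂
    field
      A1 : ⟪ m₁ ⊎ m₂ ⟫⊨ E
      A2 : ∀ ϱ₁ m₁′ → FiringSequence N₁ m₁ ϱ₁ m₁′ →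
           (Σ[ m₂′ ∈ Marking (places N₂) ] ⟪ m₁′ ⊎ m₂′ ⟫⊨ E) ×
           (∀ (m₂′ : Marking (places N₂)) → ⟪ m₁′ ⊎ m₂′ ⟫⊨ E →
            ∃[ ϱ₂ ] (FiringSequence N₂ m₂ ϱ₂ m₂′ × labels N₁ ϱ₁ ≡ labels N₂ ϱ₂))

  _▷[_]_ : ∀ {A} → MarkedNet A → Formula → MarkedNet A → Set
  𝓝₁ ▷[ E ] 𝓝₂ = (𝓝₁ ⊒[ E ] 𝓝₂) × (𝓝₂ ⊒[ E ] 𝓝₁)

  Fresh : ∀ {A} → Net A → Formula → Net A → Var → Set
  Fresh N₁ E N₂ x = x ∈ vars E × x ∉ places N₁ ++ places N₂

  -- M is compatible with respect to a statement (N₁ , m₁) ▷[ E ] (N₂ , m₂).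

  record CompatibleNet {A B} (N₁ : Net A) (E : Formula) (N₂ : Net A)
                       (M : Net B) : Set where
    field
      disjoint : Disjoint (places N₁ ++ places N₂) (places M)
      fresh    : ∀ x → Fresh N₁ E N₂ x → x ∉ places M

  ----------------------------------------------------------------------
  -- Synchronous product

  -- Proofs are irrelevant, so a transition is determined by its components.
  -- Two silent transitions may also be paired, their labels being equal.

  data ProductTransition {A B} (N : Net A) (M : Net B) : Set where
    ⟨_,∘⟩[_] : (t : Transition N) → .(¬ IsLetter B (label N t)) → ProductTransition N M
    ⟨∘,_⟩[_] : (u : Transition M) → .(¬ IsLetter A (label M u)) → ProductTransition N M
    ⟨_,_⟩[_] : (t : Transition N) (u : Transition M) →
               .(label N t ≡ label M u) → ProductTransition N M

  private
    only : ∀ {X : Set} {Q : Set} → Dec Q → (.Q → X) → List X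
    only (yes q) f = f q ∷ []
    only (no _)  f = []

    ∈-only : ∀ {X : Set} {Q : Set} (Q? : Dec Q) (f : .Q → X) .(q : Q) → f q ∈ only Q? f
    ∈-only (yes _) f q = here refl
    ∈-only (no ¬q) f q = absurd (¬q q)
      where
      absurd : ∀ {Y : Set} → .⊥ → Y
      absurd ()

  module _ {A B} (N : Net A) (M : Net B) where
    private
      lefts : Transition N → List (ProductTransition N M)
      lefts t = only (¬? (Maybe∃.dec (letter? B) (label N t))) ⟨ t ,∘⟩[_]

      rights : Transition M → List (ProductTransition N M)
      rights u = only (¬? (Maybe∃.dec (letter? A) (label M u))) ⟨∘, u ⟩[_]

      pairs : Transition N × Transition M → List (ProductTransition N M)
      pairs (t , u) = only (≡-dec _≟ᵃ_ (label N t) (label M u)) ⟨ t , u ⟩[_]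

      ∈-via : ∀ {X Y : Set} (f : X → List Y) {x y xs} → x ∈ xs → y ∈ f x → y ∈ concatMap f xs
      ∈-via f x∈xs y∈fx = ∈-concatMap⁺ f (List∃.map (λ { refl → y∈fx }) x∈xs)

    productTransitions : List (ProductTransition N M)
    productTransitions =
      concatMap lefts (transitions N) ++
      concatMap rights (transitions M) ++
      concatMap pairs (cartesianProduct (transitions N) (transitions M))

    productComplete : IsEnumeration (setoid (ProductTransition N M)) productTransitions
    productComplete ⟨ t ,∘⟩[ q ] =
      ∈-++⁺ˡ (∈-via lefts (complete N t) (∈-only (¬? (Maybe∃.dec (letter? B) _)) _ q))
    productComplete ⟨∘, u ⟩[ q ] =
      ∈-++⁺ʳ (concatMap lefts (transitions N)) (∈-++⁺ˡ
        (∈-via rights (complete M u) (∈-only (¬? (Maybe∃.dec (letter? A) _)) _ q)))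
    productComplete ⟨ t , u ⟩[ q ] =
      ∈-++⁺ʳ (concatMap lefts (transitions N))
        (∈-++⁺ʳ (concatMap rights (transitions M))
          (∈-via pairs (∈-cartesianProduct⁺ (complete N t) (complete M u))
                       (∈-only (≡-dec _≟ᵃ_ _ _) _ q)))

    productLabel : ProductTransition N M → Label
    productLabel ⟨ t ,∘⟩[ _ ]  = label N t
    productLabel ⟨∘, u ⟩[ _ ]  = label M u
    productLabel ⟨ t , u ⟩[ _ ] = label N t

    productLabel-valid : ∀ t → All (letters (A ∪ₐ B)) (productLabel t)
    productLabel-valid ⟨ t ,∘⟩[ _ ]  = Maybe∀.map inj₁ (label-valid N t)
    productLabel-valid ⟨∘, u ⟩[ _ ]  = Maybe∀.map inj₂ (label-valid M u)
    productLabel-valid ⟨ t , u ⟩[ _ ] = Maybe∀.map inj₁ (label-valid N t)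

    private
      none : ∀ {P} → Marking P
      none _ = 0

    -- Weights on places N ++ places M are unions, like markings, with weight 0
    -- on the side of a component ∘.

    productFlow : (Transition N → Place (places N) → ℕ) →
                  (Transition M → Place (places M) → ℕ) →
                  ProductTransition N M → Place (places N ++ places M) → ℕ
    productFlow f g ⟨ t ,∘⟩[ _ ]  = f t ⊎ₘ none
    productFlow f g ⟨∘, u ⟩[ _ ]  = none ⊎ₘ g u
    productFlow f g ⟨ t , u ⟩[ _ ] = f t ⊎ₘ g u

  infixr 5 _∥ₙ_ _∥_

  -- As in the definition of ⊎ₘ, the places of N and M are meant to be disjoint.

  _∥ₙ_ : ∀ {A B} → Net A → Net B → Net (A ∪ₐ B)
  N ∥ₙ M = record
    { places      = places N ++ places M
    ; Transition  = ProductTransition N M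
    ; transitions = productTransitions N M
    ; complete    = productComplete N M
    ; Pre         = productFlow N M (Pre N) (Pre M)
    ; Post        = productFlow N M (Post N) (Post M)
    ; label       = productLabel N M
    ; label-valid = productLabel-valid N M
    }

  _∥_ : ∀ {A B} → MarkedNet A → MarkedNet B → MarkedNet (A ∪ₐ B)
  (N , m) ∥ (M , m′) = (N ∥ₙ M) , (m ⊎ₘ m′)

-- A run of a product N ∥ M is the same thing as a run of N and a run of M
-- whose words synchronise. Exchanging N₁ for N₂ in a run of N₁ ∥ M therefore
-- amounts to exchanging the run of N₁ for a run of N₂ with the same word.
-- On the logical side m ⊎ m′ ⊨ E asks for a valuation that satisfies E and
-- extends both markings; since no place of M occurs in E, such a valuation can
-- be redefined on these places to agree with any marking of M.

module Submission where

open import Defs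
open import Data.Empty using (⊥-elim-irr)
open import Data.Integer.Base as ℤ using (+_)
open import Data.Integer.Properties using (+-injective)
open import Data.Irrelevant using ([_])
open import Data.List.Base using (List; []; _∷_; _++_)
open import Data.List.Membership.Propositional using (_∈_; _∉_; mapWith∈)
open import Data.List.Membership.Propositional.Properties
  using (∈-++⁺ˡ; ∈-++⁺ʳ; ∈-++⁻)
import Data.List.Membership.DecPropositional as DecMembership
open import Data.List.Relation.Binary.Disjoint.Propositional using (Disjoint)
open import Data.List.Relation.Unary.Any using (here; there)
open import Data.Maybe.Base using (nothing; just)
open import Data.Maybe.Properties using (≡-dec)
open import Data.Maybe.Relation.Unary.Any using (just)
import Data.Nat.Base as ℕ
open import Data.Nat.Properties using (+-identityʳ)
open import Data.Product.Base using (Σ-syntax; ∃-syntax; _×_; _,_)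
open import Data.Refinement using (value; _,_)
open import Data.Sum.Base as Sum using ([_,_]′)
open import Data.Unit.Base using (tt)
open import Function.Base using (_∘_)
open import Relation.Binary.Definitions using (DecidableEquality)
open import Relation.Binary.PropositionalEquality
  using (_≡_; _≗_; refl; sym; trans; cong; cong₂; subst; subst₂)
open import Relation.Nullary using (¬_; yes; no)
open import Relation.Nullary.Decidable using (recompute)

module _ {Var Act : Set}
         (_≟ᵛ_ : DecidableEquality Var) (_≟ᵃ_ : DecidableEquality Act) where

  open PetriNets _≟ᵛ_ _≟ᵃ_
  open DecMembership _≟ᵛ_ using (_∈?_)

  -- Unions of markings

  restrictˡ : ∀ {P Q} → Marking (P ++ Q) → Marking P
  restrictˡ μ (x , [ x∈P ]) = μ (x , [ ∈-++⁺ˡ x∈P ])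

  restrictʳ : ∀ P {Q} → Marking (P ++ Q) → Marking Q
  restrictʳ P μ (x , [ x∈Q ]) = μ (x , [ ∈-++⁺ʳ P x∈Q ])

  restrictˡ-⊎ₘ : ∀ {P Q} (m : Marking P) (n : Marking Q) → restrictˡ (m ⊎ₘ n) ≗ m
  restrictˡ-⊎ₘ {P} m n (x , [ x∈P ]) with x ∈? P
  ... | yes _  = refl
  ... | no x∉P = ⊥-elim-irr (x∉P x∈P)

  -- Disjointness rules out the case in which the left-biased union takes its value from `m`.
  restrictʳ-⊎ₘ : ∀ {P Q} → Disjoint P Q → (m : Marking P) (n : Marking Q) →
                 restrictʳ P (m ⊎ₘ n) ≗ n
  restrictʳ-⊎ₘ {P} P∩Q=∅ m n (x , [ x∈Q ]) with x ∈? P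
  ... | yes x∈P = ⊥-elim-irr (P∩Q=∅ (x∈P , x∈Q))
  ... | no  _   = refl

  ⊎ₘ-restrict : ∀ P {Q} (μ : Marking (P ++ Q)) → restrictˡ μ ⊎ₘ restrictʳ P μ ≗ μ
  ⊎ₘ-restrict P μ (x , [ _ ]) with x ∈? P
  ... | yes _ = refl
  ... | no  _ = refl

  ⊎ₘ-cong : ∀ {P Q} {m m′ : Marking P} {n n′ : Marking Q} →
            m ≗ m′ → n ≗ n′ → m ⊎ₘ n ≗ m′ ⊎ₘ n′
  ⊎ₘ-cong {P} m≗m′ n≗n′ (x , [ _ ]) with x ∈? P
  ... | yes _ = m≗m′ _
  ... | no  _ = n≗n′ _

  -- Valuations

  Extends : ∀ {P} → Valuation → Marking P → Set
  Extends v m = ∀ p → v (value p) ≡ + m p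

  Extends-⊎ₘ : ∀ {P Q v} {m : Marking P} {n : Marking Q} →
               Extends v m → Extends v n → Extends v (m ⊎ₘ n)
  Extends-⊎ₘ {P} v⊇m v⊇n (x , [ _ ]) with x ∈? P
  ... | yes _ = v⊇m _
  ... | no  _ = v⊇n _

  Extends-resp : ∀ {P v} {m m′ : Marking P} → m ≗ m′ → Extends v m → Extends v m′
  Extends-resp m≗m′ v⊇m p = trans (v⊇m p) (cong +_ (m≗m′ p))

  Extends-unique : ∀ {P v} {m m′ : Marking P} → Extends v m → Extends v m′ → m ≗ m′
  Extends-unique v⊇m v⊇m′ p = +-injective (trans (sym (v⊇m p)) (v⊇m′ p))

  ⋀-mapWith∈⁺ : ∀ {v} (P : List Var) (φ : ∀ {x} → x ∈ P → Formula) →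
                (∀ {x} (x∈P : x ∈ P) → ⟦ φ x∈P ⟧ v) → ⟦ ⋀ (mapWith∈ P φ) ⟧ v
  ⋀-mapWith∈⁺ []      φ h = tt
  ⋀-mapWith∈⁺ (x ∷ P) φ h = h (here refl) , ⋀-mapWith∈⁺ P (φ ∘ there) (h ∘ there)

  ⋀-mapWith∈⁻ : ∀ {v} (P : List Var) (φ : ∀ {x} → x ∈ P → Formula) →
                ⟦ ⋀ (mapWith∈ P φ) ⟧ v → ∀ {x} (x∈P : x ∈ P) → ⟦ φ x∈P ⟧ v
  ⋀-mapWith∈⁻ (x ∷ P) φ (h , _) (here refl) = h
  ⋀-mapWith∈⁻ (x ∷ P) φ (_ , h) (there x∈P) = ⋀-mapWith∈⁻ P (φ ∘ there) h x∈P

  ⌜⌝⁺ : ∀ {P v} (m : Marking P) → Extends v m → ⟦ ⌜ m ⌝ ⟧ v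
  ⌜⌝⁺ {P} m v⊇m = ⋀-mapWith∈⁺ P _ λ x∈P → v⊇m (_ , [ x∈P ])

  ⌜⌝⁻ : ∀ {P v} (m : Marking P) → ⟦ ⌜ m ⌝ ⟧ v → Extends v m
  -- The conjunct is found by recursion on a membership proof, but the one stored in a place is
  -- irrelevant; decidability of `∈` supplies a usable one.
  ⌜⌝⁻ {P} m h (x , [ x∈P ]) = ⋀-mapWith∈⁻ P _ h (recompute (x ∈? P) x∈P)

  -- Semantic form of `⟪ m ⊎ n ⟫⊨ φ`, without the biased union. Compatibility is implicit: a
  -- valuation gives a shared name one value, and `+_` is injective.
  Model : ∀ {P Q} → Marking P → Marking Q → Formula → Set
  Model m n φ = Σ[ v ∈ Valuation ] ⟦ φ ⟧ v × Extends v m × Extends v n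

  ⊨⇒Model : ∀ {P Q} {m : Marking P} {n : Marking Q} {φ} → ⟪ m ⊎ n ⟫⊨ φ → Model m n φ
  ⊨⇒Model {P} {Q} {m} {n} (m∼n , v , ⟦φ⟧ , ⟦m⊎n⟧) = v , ⟦φ⟧ , v⊇m , v⊇n
    where
    v⊇m⊎n : Extends v (m ⊎ₘ n)
    v⊇m⊎n = ⌜⌝⁻ (m ⊎ₘ n) ⟦m⊎n⟧

    v⊇m : Extends v m
    v⊇m = Extends-resp (restrictˡ-⊎ₘ m n) λ (x , [ x∈P ]) → v⊇m⊎n (x , [ ∈-++⁺ˡ x∈P ])

    v⊇n : Extends v n
    v⊇n (x , [ x∈Q ]) with x ∈? P | v⊇m⊎n (x , [ ∈-++⁺ʳ P x∈Q ])
    -- At a shared name the union takes its value from `m`; compatibility turns it into the value of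
    -- `n`.
    ... | yes x∈P | vx≡m = trans vx≡m (cong +_ (m∼n (x , [ x∈P ]) (x , [ x∈Q ]) refl))
    ... | no  _   | vx≡n = vx≡n

  Model⇒⊨ : ∀ {P Q} {m : Marking P} {n : Marking Q} {φ} → Model m n φ → ⟪ m ⊎ n ⟫⊨ φ
  Model⇒⊨ {m = m} {n} (v , ⟦φ⟧ , v⊇m , v⊇n) =
    (λ { p q refl → +-injective (trans (sym (v⊇m p)) (v⊇n q)) }) ,
    v , ⟦φ⟧ , ⌜⌝⁺ (m ⊎ₘ n) (Extends-⊎ₘ v⊇m v⊇n)

  -- Changing a valuation outside the variables of a formula

  ⟦⟧ₜ-local : ∀ {v w} t → (∀ {x} → x ∈ varsₜ t → v x ≡ w x) → ⟦ t ⟧ₜ v ≡ ⟦ t ⟧ₜ w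
  ⟦⟧ₜ-local (con k) v≡w = refl
  ⟦⟧ₜ-local (var x) v≡w = v≡w (here refl)
  ⟦⟧ₜ-local (s ⊕ t) v≡w =
    cong₂ ℤ._+_ (⟦⟧ₜ-local s (v≡w ∘ ∈-++⁺ˡ)) (⟦⟧ₜ-local t (v≡w ∘ ∈-++⁺ʳ (varsₜ s)))
  ⟦⟧ₜ-local (k · t) v≡w = cong (k ℤ.*_) (⟦⟧ₜ-local t v≡w)

  ⟦⟧-local : ∀ {v w} φ → (∀ {x} → x ∈ vars φ → v x ≡ w x) → ⟦ φ ⟧ v → ⟦ φ ⟧ w
  ⟦⟧-local (s ≐ t) v≡w =
    subst₂ _≡_ (⟦⟧ₜ-local s (v≡w ∘ ∈-++⁺ˡ)) (⟦⟧ₜ-local t (v≡w ∘ ∈-++⁺ʳ (varsₜ s)))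
  ⟦⟧-local (s ≼ t) v≡w =
    subst₂ ℤ._≤_ (⟦⟧ₜ-local s (v≡w ∘ ∈-++⁺ˡ)) (⟦⟧ₜ-local t (v≡w ∘ ∈-++⁺ʳ (varsₜ s)))
  ⟦⟧-local true    v≡w _ = tt
  ⟦⟧-local (φ ∧ ψ) v≡w (h , k) =
    ⟦⟧-local φ (v≡w ∘ ∈-++⁺ˡ) h , ⟦⟧-local ψ (v≡w ∘ ∈-++⁺ʳ (vars φ)) k
  ⟦⟧-local (φ ∨ ψ) v≡w =
    Sum.map (⟦⟧-local φ (v≡w ∘ ∈-++⁺ˡ)) (⟦⟧-local ψ (v≡w ∘ ∈-++⁺ʳ (vars φ)))
  ⟦⟧-local (not φ) v≡w ¬h h = ¬h (⟦⟧-local φ (sym ∘ v≡w) h)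

  infixl 5 _◁_

  -- Overwrites `v` by `m`: on names in `P` the marking takes precedence.
  _◁_ : ∀ {P} → Valuation → Marking P → Valuation
  _◁_ {P} v m x with x ∈? P
  ... | yes x∈P = + m (x , [ x∈P ])
  ... | no  _   = v x

  ◁-extends : ∀ {P} v (m : Marking P) → Extends (v ◁ m) m
  ◁-extends {P} v m (x , [ x∈P ]) with x ∈? P
  ... | yes _  = refl
  ... | no x∉P = ⊥-elim-irr (x∉P x∈P)

  ◁-∉ : ∀ {P x} v (m : Marking P) → .(x ∉ P) → v x ≡ (v ◁ m) x
  ◁-∉ {P} {x} v m x∉P with x ∈? P
  ... | yes x∈P = ⊥-elim-irr (x∉P x∈P)
  ... | no  _   = refl

  ◁-Extends : ∀ {P Q v} {m : Marking P} (n : Marking Q) → Disjoint P Q →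
              Extends v m → Extends (v ◁ n) m
  ◁-Extends {v = v} n P∩Q=∅ v⊇m p@(x , [ x∈P ]) =
    trans (sym (◁-∉ v n λ x∈Q → P∩Q=∅ (x∈P , x∈Q))) (v⊇m p)

  -- Runs

  module _ {A} (N : Net A) where

    Fires-resp : ∀ {m m′ n n′ t} → m ≗ n → m′ ≗ n′ → Fires N m t m′ → Fires N n t n′
    Fires-resp {t = t} m≗n m′≗n′ f = record
      { enabled = λ p → subst (_ ℕ.≤_) (m≗n p) (Fires.enabled f p)
      ; result  = λ p → trans (sym (m′≗n′ p))
          (trans (Fires.result f p) (cong (λ k → k ℕ.∸ Pre N t p ℕ.+ Post N t p) (m≗n p)))
      }

    -- A firing sequence that shows only its word. Transitions of different nets cannot be compared,
    -- words can; separate constructors for silent and visible steps let a run be matched against a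
    -- word letter by letter.
    data Run (m : Marking (places N)) : List Act → Marking (places N) → Set where
      done    : ∀ {m′} → m ≗ m′ → Run m [] m′
      silent  : ∀ {m′ m″ t w} → label N t ≡ nothing →
                Fires N m t m′ → Run m′ w m″ → Run m w m″
      visible : ∀ {m′ m″ t a w} → label N t ≡ just a →
                Fires N m t m′ → Run m′ w m″ → Run m (a ∷ w) m″

    Run-respˡ : ∀ {m n w m′} → m ≗ n → Run m w m′ → Run n w m′
    Run-respˡ m≗n (done e)        = done λ p → trans (sym (m≗n p)) (e p)
    Run-respˡ m≗n (silent l f r)  = silent l (Fires-resp m≗n (λ _ → refl) f) r
    Run-respˡ m≗n (visible l f r) = visible l (Fires-resp m≗n (λ _ → refl) f) r

    Run-respʳ : ∀ {m w m′ n′} → m′ ≗ n′ → Run m w m′ → Run m w n′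
    Run-respʳ m′≗n′ (done e)        = done λ p → trans (e p) (m′≗n′ p)
    Run-respʳ m′≗n′ (silent l f r)  = silent l f (Run-respʳ m′≗n′ r)
    Run-respʳ m′≗n′ (visible l f r) = visible l f (Run-respʳ m′≗n′ r)

    firings⇒Run : ∀ {m ϱ m′} → FiringSequence N m ϱ m′ → Run m (labels N ϱ) m′
    firings⇒Run ([] e) = done e
    firings⇒Run (_∷_ {t = t} f fs) with label N t in l
    ... | nothing = silent l f (firings⇒Run fs)
    ... | just _  = visible l f (firings⇒Run fs)

    Run⇒firings : ∀ {m w m′} → Run m w m′ →
                  ∃[ ϱ ] (FiringSequence N m ϱ m′ × w ≡ labels N ϱ)
    Run⇒firings (done e) = [] , [] e , refl
    Run⇒firings (silent {t = t} l f r) with Run⇒firings r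
    ... | ϱ , fs , refl = t ∷ ϱ , f ∷ fs , eq
      where
      -- `labels N (t ∷ ϱ)` reduces only once the label of `t` is known, hence the rewriting by `l`.
      eq : labels N ϱ ≡ labels N (t ∷ ϱ)
      eq rewrite l = refl
    Run⇒firings (visible {t = t} {a = a} l f r) with Run⇒firings r
    ... | ϱ , fs , refl = t ∷ ϱ , f ∷ fs , eq
      where
      eq : a ∷ labels N ϱ ≡ labels N (t ∷ ϱ)
      eq rewrite l = refl

  -- Condition A2 at the level of words: the equality of label sequences becomes the shared index
  -- `w`, so that a run of `N₂` can directly take the place of one of `N₁`.
  ⊒-runs : ∀ {A N₁ N₂ m₁ m₂ E} → _⊒[_]_ {A} (N₁ , m₁) E (N₂ , m₂) →
           ∀ {w m₁′} → Run N₁ m₁ w m₁′ →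
           (∃[ m₂′ ] Model m₁′ m₂′ E) × (∀ m₂′ → Model m₁′ m₂′ E → Run N₂ m₂ w m₂′)
  ⊒-runs {N₁ = N₁} {N₂} N₁⊒N₂ r with Run⇒firings N₁ r
  ... | ϱ , fs , refl with _⊒[_]_.A2 N₁⊒N₂ ϱ _ fs
  ... | (m₂′ , h) , reach = (m₂′ , ⊨⇒Model h) , λ m₂″ h′ →
    let ϱ₂ , fs₂ , eq = reach m₂″ (Model⇒⊨ h′)
    in subst (λ w → Run N₂ _ w m₂″) (sym eq) (firings⇒Run N₂ fs₂)

  -- Products

  -- Synchronised shuffle: the third word interleaves the first two, merging the letters that are
  -- performed jointly. Silent steps leave no trace in words and need no constructor.
  data Sync (A B : Alphabet) : List Act → List Act → List Act → Set where
    []    : Sync A B [] [] []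
    left  : ∀ {a u v w} → .(¬ letters B a) → Sync A B u v w → Sync A B (a ∷ u) v (a ∷ w)
    right : ∀ {a u v w} → .(¬ letters A a) → Sync A B u v w → Sync A B u (a ∷ v) (a ∷ w)
    both  : ∀ {a u v w} → Sync A B u v w → Sync A B (a ∷ u) (a ∷ v) (a ∷ w)

  nothing-∉ : ∀ (A : Alphabet) {l} → l ≡ nothing → ¬ IsLetter A l
  nothing-∉ A refl ()

  just-∉⁺ : ∀ (A : Alphabet) {l a} → l ≡ just a → ¬ letters A a → ¬ IsLetter A l
  just-∉⁺ A refl a∉A (just a∈A) = a∉A a∈A

  just-∉⁻ : ∀ (A : Alphabet) {l a} → l ≡ just a → ¬ IsLetter A l → ¬ letters A a
  just-∉⁻ A refl l∉A a∈A = l∉A (just a∈A)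

  -- The firing rule for arbitrary flow vectors: a component ∘ of a product
  -- transition moves its net by the zero flow, which no transition need have.

  record Moves {P} (pre post m m′ : Marking P) : Set where
    constructor moves
    field
      enabled : ∀ p → pre p ℕ.≤ m p
      result  : ∀ p → m′ p ≡ m p ℕ.∸ pre p ℕ.+ post p

  Moves-⊎ₘ : ∀ {P Q} {pre post m m′ : Marking P} {pre′ post′ n n′ : Marking Q} →
             Moves pre post m m′ → Moves pre′ post′ n n′ →
             Moves (pre ⊎ₘ pre′) (post ⊎ₘ post′) (m ⊎ₘ n) (m′ ⊎ₘ n′)
  Moves-⊎ₘ {P} {Q} {pre} {post} {m} {m′} {pre′} {post′} {n} {n′} (moves e r) (moves e′ r′) =
    moves pre≤ res
    where
    pre≤ : ∀ p → (pre ⊎ₘ pre′) p ℕ.≤ (m ⊎ₘ n) p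
    pre≤ (x , [ _ ]) with x ∈? P
    ... | yes _ = e _
    ... | no  _ = e′ _

    res : ∀ p → (m′ ⊎ₘ n′) p ≡ (m ⊎ₘ n) p ℕ.∸ (pre ⊎ₘ pre′) p ℕ.+ (post ⊎ₘ post′) p
    res (x , [ _ ]) with x ∈? P
    ... | yes _ = r _
    ... | no  _ = r′ _

  Moves-resp : ∀ {P} {pre pre′ post post′ m m′ : Marking P} →
               pre ≗ pre′ → post ≗ post′ → Moves pre post m m′ → Moves pre′ post′ m m′
  Moves-resp {m = m} pre≗ post≗ (moves e r) = moves
    (λ p → subst (ℕ._≤ _) (pre≗ p) (e p))
    (λ p → trans (r p) (cong₂ (λ k l → m p ℕ.∸ k ℕ.+ l) (pre≗ p) (post≗ p)))

  stay : ∀ {P} {m : Marking P} → Moves (λ _ → 0) (λ _ → 0) m m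
  stay = moves (λ _ → ℕ.z≤n) (λ p → sym (+-identityʳ _))

  stay⁻ : ∀ {P} {m m′ : Marking P} → Moves (λ _ → 0) (λ _ → 0) m m′ → m′ ≗ m
  stay⁻ {m = m} (moves _ r) p = trans (r p) (+-identityʳ (m p))

  Moves-restrict : ∀ {P Q} → Disjoint P Q →
    ∀ {pre post : Marking P} {pre′ post′ : Marking Q} {μ μ′ : Marking (P ++ Q)} →
    Moves (pre ⊎ₘ pre′) (post ⊎ₘ post′) μ μ′ →
    Moves pre post (restrictˡ μ) (restrictˡ μ′) ×
    Moves pre′ post′ (restrictʳ P μ) (restrictʳ P μ′)
  Moves-restrict {P} {Q} P∩Q=∅ {pre} {post} {pre′} {post′} {μ} {μ′} (moves e r) =
    Moves-resp (restrictˡ-⊎ₘ pre pre′) (restrictˡ-⊎ₘ post post′)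
      (moves (λ (x , [ x∈P ]) → e (x , [ ∈-++⁺ˡ x∈P ]))
             (λ (x , [ x∈P ]) → r (x , [ ∈-++⁺ˡ x∈P ]))) ,
    Moves-resp (restrictʳ-⊎ₘ P∩Q=∅ pre pre′) (restrictʳ-⊎ₘ P∩Q=∅ post post′)
      (moves (λ (x , [ x∈Q ]) → e (x , [ ∈-++⁺ʳ P x∈Q ]))
             (λ (x , [ x∈Q ]) → r (x , [ ∈-++⁺ʳ P x∈Q ])))

  module _ {A} {N : Net A} {m m′ : Marking (places N)} {t : Transition N} where

    Fires⇒Moves : Fires N m t m′ → Moves (Pre N t) (Post N t) m m′
    Fires⇒Moves f = moves (Fires.enabled f) (Fires.result f)

    Moves⇒Fires : Moves (Pre N t) (Post N t) m m′ → Fires N m t m′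
    Moves⇒Fires (moves e r) = record { enabled = e ; result = r }

  -- Composing and decomposing runs of a product

  module _ {A B} (N : Net A) (M : Net B) where

    leftFires : ∀ {m m′ n t} .(q : ¬ IsLetter B (label N t)) →
                Fires N m t m′ → Fires (N ∥ₙ M) (m ⊎ₘ n) ⟨ t ,∘⟩[ q ] (m′ ⊎ₘ n)
    leftFires q f = Moves⇒Fires (Moves-⊎ₘ (Fires⇒Moves f) stay)

    rightFires : ∀ {m n n′ u} .(q : ¬ IsLetter A (label M u)) →
                 Fires M n u n′ → Fires (N ∥ₙ M) (m ⊎ₘ n) ⟨∘, u ⟩[ q ] (m ⊎ₘ n′)
    rightFires q g = Moves⇒Fires (Moves-⊎ₘ stay (Fires⇒Moves g))

    bothFire : ∀ {m m′ n n′ t u} .(q : label N t ≡ label M u) →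
               Fires N m t m′ → Fires M n u n′ →
               Fires (N ∥ₙ M) (m ⊎ₘ n) ⟨ t , u ⟩[ q ] (m′ ⊎ₘ n′)
    bothFire q f g = Moves⇒Fires (Moves-⊎ₘ (Fires⇒Moves f) (Fires⇒Moves g))

    -- Silent steps of either net are fired alone, whatever `s` is, since `nothing` is a letter of
    -- no alphabet; visible steps follow `s`. Every call shortens at least one of the two runs.
    compose : ∀ {u v w m m′ n n′} → Sync A B u v w → Run N m u m′ → Run M n v n′ →
              Run (N ∥ₙ M) (m ⊎ₘ n) w (m′ ⊎ₘ n′)
    compose s (silent l f r) r′ = silent l (leftFires (nothing-∉ B l) f) (compose s r r′)
    compose s r (silent l g r′) = silent l (rightFires (nothing-∉ A l) g) (compose s r r′)
    compose [] (done e) (done e′) = done (⊎ₘ-cong e e′)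
    compose (left a∉B s) (visible l f r) r′ =
      visible l (leftFires (just-∉⁺ B l a∉B) f) (compose s r r′)
    compose (right a∉A s) r (visible l g r′) =
      visible l (rightFires (just-∉⁺ A l a∉A) g) (compose s r r′)
    compose (both s) (visible l f r) (visible l′ g r′) =
      visible l (bothFire (trans l (sym l′)) f g) (compose s r r′)

    Decomposition : Marking (places N ++ places M) → List Act →
                    Marking (places N ++ places M) → Set
    Decomposition μ w μ′ = ∃[ u ] ∃[ v ] (Sync A B u v w ×
      Run N (restrictˡ μ) u (restrictˡ μ′) ×
      Run M (restrictʳ (places N) μ) v (restrictʳ (places N) μ′))

    -- By `Moves-restrict`, a product step moves each component by its own flow or by zero. A zero
    -- move fixes the marking pointwise, so it is absorbed by `Run-respˡ` and adds no step.
    decompose : Disjoint (places N) (places M) →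
                ∀ {μ w μ′} → Run (N ∥ₙ M) μ w μ′ → Decomposition μ w μ′
    decompose N∩M=∅ (done e) =
      [] , [] , [] , done (λ (x , _) → e (x , _)) , done (λ (x , _) → e (x , _))
    decompose N∩M=∅ (silent {t = t} l f r)
      with decompose N∩M=∅ r
    ... | u , v , s , rN , rM with t
    ... | ⟨ _ ,∘⟩[ _ ] =
      let mvN , mvM = Moves-restrict N∩M=∅ (Fires⇒Moves f)
      in u , v , s , silent l (Moves⇒Fires mvN) rN , Run-respˡ M (stay⁻ mvM) rM
    ... | ⟨∘, _ ⟩[ _ ] =
      let mvN , mvM = Moves-restrict N∩M=∅ (Fires⇒Moves f)
      in u , v , s , Run-respˡ N (stay⁻ mvN) rN , silent l (Moves⇒Fires mvM) rM
    -- A pair of silent transitions splits into one silent step on each side. The equality `q` of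
    -- their labels is irrelevant and is recovered by deciding it.
    ... | ⟨ _ , _ ⟩[ q ] =
      let mvN , mvM = Moves-restrict N∩M=∅ (Fires⇒Moves f)
      in u , v , s , silent l (Moves⇒Fires mvN) rN ,
         silent (trans (sym (recompute (≡-dec _≟ᵃ_ _ _) q)) l) (Moves⇒Fires mvM) rM
    decompose N∩M=∅ (visible {t = t} l f r)
      with decompose N∩M=∅ r
    ... | u , v , s , rN , rM with t
    ... | ⟨ _ ,∘⟩[ q ] =
      let mvN , mvM = Moves-restrict N∩M=∅ (Fires⇒Moves f)
      in _ , v , left (just-∉⁻ B l q) s ,
         visible l (Moves⇒Fires mvN) rN , Run-respˡ M (stay⁻ mvM) rM
    ... | ⟨∘, _ ⟩[ q ] =
      let mvN , mvM = Moves-restrict N∩M=∅ (Fires⇒Moves f)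
      in u , _ , right (just-∉⁻ A l q) s ,
         Run-respˡ N (stay⁻ mvN) rN , visible l (Moves⇒Fires mvM) rM
    ... | ⟨ _ , _ ⟩[ q ] =
      let mvN , mvM = Moves-restrict N∩M=∅ (Fires⇒Moves f)
      in _ , _ , both s , visible l (Moves⇒Fires mvN) rN ,
         visible (trans (sym (recompute (≡-dec _≟ᵃ_ _ _) q)) l) (Moves⇒Fires mvM) rM

  -- Abstraction is preserved by products

  Model-∥ : ∀ {P Q R} {m₁ : Marking P} {m₂ : Marking Q} {E} (n : Marking R) →
            Disjoint (P ++ Q) R → (∀ {x} → x ∈ vars E → x ∉ R) →
            Model m₁ m₂ E → Model (m₁ ⊎ₘ n) (m₂ ⊎ₘ n) E
  Model-∥ {P} {E = E} n PQ∩R=∅ E∩R=∅ (v , ⟦E⟧ , v⊇m₁ , v⊇m₂) =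
    v ◁ n , ⟦⟧-local E (λ x∈E → ◁-∉ v n (E∩R=∅ x∈E)) ⟦E⟧ ,
    Extends-⊎ₘ (◁-Extends n (λ (x∈P , x∈R) → PQ∩R=∅ (∈-++⁺ˡ x∈P , x∈R)) v⊇m₁) (◁-extends v n) ,
    Extends-⊎ₘ (◁-Extends n (λ (x∈Q , x∈R) → PQ∩R=∅ (∈-++⁺ʳ P x∈Q , x∈R)) v⊇m₂) (◁-extends v n)

  -- Lets both directions of the equivalence follow from `⊒-∥`, with `N₁` and `N₂` exchanged for the
  -- second.
  CompatibleNet-sym : ∀ {A B} {N₁ N₂ : Net A} {E} {M : Net B} →
                      CompatibleNet N₁ E N₂ M → CompatibleNet N₂ E N₁ M
  CompatibleNet-sym {N₁ = N₁} {N₂} c = record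
    { disjoint = λ (x∈ , x∈M) → CompatibleNet.disjoint c (swap (places N₂) (places N₁) x∈ , x∈M)
    ; fresh    = λ x (x∈E , x∉) →
        CompatibleNet.fresh c x (x∈E , λ x∈ → x∉ (swap (places N₁) (places N₂) x∈))
    }
    where
    swap : ∀ {x} P Q → x ∈ P ++ Q → x ∈ Q ++ P
    swap P Q x∈ = [ ∈-++⁺ʳ Q , ∈-++⁺ˡ ]′ (∈-++⁻ P x∈)

  -- A variable of `E` is either a place of `N₁` or `N₂`, excluded by `disjoint`, or fresh, excluded
  -- by `fresh`.
  vars∩places=∅ : ∀ {A B} {N₁ N₂ : Net A} {E} {M : Net B} → CompatibleNet N₁ E N₂ M →
                  ∀ {x} → x ∈ vars E → x ∉ places M
  vars∩places=∅ {N₁ = N₁} {N₂} c {x} x∈E x∈M with x ∈? (places N₁ ++ places N₂)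
  ... | yes x∈ = CompatibleNet.disjoint c (x∈ , x∈M)
  ... | no x∉  = CompatibleNet.fresh c x (x∈E , x∉) x∈M

  ⊒-∥ : ∀ {A B} (N₁ N₂ : Net A) m₁ m₂ E (M : Net B) m →
        CompatibleNet N₁ E N₂ M → (N₁ , m₁) ⊒[ E ] (N₂ , m₂) →
        ((N₁ , m₁) ∥ (M , m)) ⊒[ E ] ((N₂ , m₂) ∥ (M , m))
  ⊒-∥ {A} {B} N₁ N₂ m₁ m₂ E M m c N₁⊒N₂ = record
    { A1 = Model⇒⊨ (extend m (⊨⇒Model (_⊒[_]_.A1 N₁⊒N₂)))
    ; A2 = λ ϱ μ₁ fs → step (firings⇒Run (N₁ ∥ₙ M) fs)
    }
    where
    P₁ = places N₁
    P₂ = places N₂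

    extend : ∀ {m₁′ : Marking P₁} {m₂′ : Marking P₂} (m′ : Marking (places M)) →
             Model m₁′ m₂′ E → Model (m₁′ ⊎ₘ m′) (m₂′ ⊎ₘ m′) E
    extend m′ = Model-∥ m′ (CompatibleNet.disjoint c) (vars∩places=∅ c)

    N₁∩M=∅ : Disjoint P₁ (places M)
    N₁∩M=∅ (x∈N₁ , x∈M) = CompatibleNet.disjoint c (∈-++⁺ˡ x∈N₁ , x∈M)

    step : ∀ {w μ₁} → Run (N₁ ∥ₙ M) (m₁ ⊎ₘ m) w μ₁ →
           (∃[ μ₂ ] ⟪ μ₁ ⊎ μ₂ ⟫⊨ E) ×
           (∀ μ₂ → ⟪ μ₁ ⊎ μ₂ ⟫⊨ E →
            ∃[ ϱ₂ ] (FiringSequence (N₂ ∥ₙ M) (m₂ ⊎ₘ m) ϱ₂ μ₂ × w ≡ labels (N₂ ∥ₙ M) ϱ₂))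
    step {w} {μ₁} run with decompose N₁ M N₁∩M=∅ run
    ... | u , v , s , r₁ , r with ⊒-runs N₁⊒N₂ (Run-respˡ N₁ (restrictˡ-⊎ₘ m₁ m) r₁)
    -- The witness keeps the marking that `μ₁` gives to the places of `M` and takes `m₂′` from the
    -- abstraction of `N₁` by `N₂`.
    ... | (m₂′ , model) , reach = (m₂′ ⊎ₘ restrictʳ P₁ μ₁ , exists) , each
      where
      exists : ⟪ μ₁ ⊎ m₂′ ⊎ₘ restrictʳ P₁ μ₁ ⟫⊨ E
      exists with extend (restrictʳ P₁ μ₁) model
      ... | v , ⟦E⟧ , v⊇₁ , v⊇₂ = Model⇒⊨ (v , ⟦E⟧ , Extends-resp (⊎ₘ-restrict P₁ μ₁) v⊇₁ , v⊇₂)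

      each : ∀ μ₂ → ⟪ μ₁ ⊎ μ₂ ⟫⊨ E →
             ∃[ ϱ₂ ] (FiringSequence (N₂ ∥ₙ M) (m₂ ⊎ₘ m) ϱ₂ μ₂ × w ≡ labels (N₂ ∥ₙ M) ϱ₂)
      each μ₂ h with ⊨⇒Model h
      ... | v , ⟦E⟧ , v⊇μ₁ , v⊇μ₂ = Run⇒firings (N₂ ∥ₙ M)
        (Run-respʳ (N₂ ∥ₙ M) (⊎ₘ-restrict P₂ μ₂)
          (compose N₂ M s
            (reach (restrictˡ μ₂)
              (v , ⟦E⟧ , (λ (x , [ _ ]) → v⊇μ₁ (x , [ _ ])) , (λ (x , [ _ ]) → v⊇μ₂ (x , [ _ ]))))
            -- `v` extends both `μ₁` and `μ₂`, so they agree on the places of `M`; the run of `M`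
            -- taken from the given run thus ends in the `M`-part of `μ₂`.
            (Run-respʳ M (Extends-unique (λ (x , [ _ ]) → v⊇μ₁ (x , [ _ ]))
                                         (λ (x , [ _ ]) → v⊇μ₂ (x , [ _ ])))
              (Run-respˡ M (restrictʳ-⊎ₘ N₁∩M=∅ m₁ m) r))))

theorem2 : ∀ {Var Act : Set} (_≟ᵛ_ : DecidableEquality Var) (_≟ᵃ_ : DecidableEquality Act) →
    let open PetriNets _≟ᵛ_ _≟ᵃ_ in
    ∀ {A B : Alphabet} (N₁ N₂ : Net A) (m₁ : Marking (places N₁)) (m₂ : Marking (places N₂))
    (E : Formula) (M : Net B) (m : Marking (places M)) →
    (N₁ , m₁) ▷[ E ] (N₂ , m₂) →
    CompatibleNet N₁ E N₂ M →
    ((N₁ , m₁) ∥ (M , m)) ▷[ E ] ((N₂ , m₂) ∥ (M , m))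
theorem2 _≟ᵛ_ _≟ᵃ_ N₁ N₂ m₁ m₂ E M m (N₁⊒N₂ , N₂⊒N₁) c =
  ⊒-∥ _≟ᵛ_ _≟ᵃ_ N₁ N₂ m₁ m₂ E M m c N₁⊒N₂ ,
  ⊒-∥ _≟ᵛ_ _≟ᵃ_ N₂ N₁ m₂ m₁ E M m (CompatibleNet-sym _≟ᵛ_ _≟ᵃ_ c) N₂⊒N₁
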